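{- Let $g$ be an odd integer with $g \geq 3$. If $G$ is a graph on $n$ vertices whose girth is $g$ or $g+1$, then $$P(G,m) - P_{DP}(G,m) = O(m^{n-g}) \quad \text{as } m \to \infty.$$ Consequently, for every graph $M$, $P(M,m) - P_{DP}(M,m) = O(m^{|V(M)|-3})$ as $m \to \infty$.
   Context: All graphs are nonempty, finite and simple. The girth of a graph is the length of a shortest cycle (infinite if the graph is acyclic). For $m \in \mathbb{N}$, $P(G,m)$ denotes the chromatic polynomial of $G$, i.e. the number of proper colorings of $G$ with colors from $\{1,\dots,m\}$. A cover of a graph $G$ is a pair $\mathcal{H}=(L,H)$ where $H$ is a graph and $L: V(G) \to \mathcal{P}(V(H))$ satisfies: (1) $\{L(u): u \in V(G)\}$ is a partition of $V(H)$; (2) for every $u \in V(G)$, $H[L(u)]$ is complete; (3) if $E_H(L(u),L(v))$ is nonempty then $u=v$ or $uv \in E(G)$; (4) if $uv \in E(G)$, then $E_H(L(u),L(v))$ is a matching (possibly empty). Here $E_H(S,U)$ is the set of edges of $H$ with one endpoint in $S$ and the other in $U$. The cover is $m$-fold if $|L(u)|=m$ for every $u$. An $\mathcal{H}$-coloring of $G$ is an independent set of $H$ of size $|V(G)|$ (equivalently an independent set meeting each $L(u)$ in exactly one vertex). $P_{DP}(G,\mathcal{H})$ is the number of $\mathcal{H}$-colorings, and the DP color function $P_{DP}(G,m)$ is the minimum of $P_{DP}(G,\mathcal{H})$ over all $m$-fold covers $\mathcal{H}$ of $G$, for $m \in \mathbb{N}$. -}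

module Defs where

open import Data.Nat using (ℕ; zero; suc; _≤_; _*_)
open import Data.Fin using (Fin; zero; suc; inject₁; fromℕ; _≟_)
open import Data.Bool using (Bool; true; false; not; _∧_; _∨_)
open import Data.Vec using (Vec; []; _∷_; lookup)
open import Data.List using (List; []; _∷_; [_]; map; concatMap; allFin; filterᵇ; foldr; length)
open import Data.Product using (Σ; _×_; ∃-syntax)
open import Data.Empty using (⊥)
open import Relation.Nullary using (¬_; does)
open import Relation.Binary.PropositionalEquality using (_≡_; _≢_)
open import Function.Definitions using (Injective)

record Graph (n : ℕ) : Set where
  field
    adj   : Fin n → Fin n → Bool
    sym   : ∀ u v → adj u v ≡ adj v u
    irrefl : ∀ u → adj u u ≡ false
open Graph public

Odd : ℕ → Set
Odd g = ∃[ k ] g ≡ suc (2 * k)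

CycleOfLength : ∀ {n} → Graph n → ℕ → Set
CycleOfLength G zero = ⊥
CycleOfLength {n} G (suc k) =
  2 ≤ k × Σ (Fin (suc k) → Fin n) λ v →
    Injective _≡_ _≡_ v ×
    (∀ (i : Fin k) → adj G (v (inject₁ i)) (v (suc i)) ≡ true) ×
    adj G (v (fromℕ k)) (v zero) ≡ true

HasGirth : ∀ {n} → Graph n → ℕ → Set
HasGirth G g = CycleOfLength G g × (∀ j → suc j ≤ g → ¬ CycleOfLength G j)

allVecs : ∀ n m → List (Vec (Fin m) n)
allVecs zero m = [ [] ]
allVecs (suc n) m = concatMap (λ c → map (c ∷_) (allVecs n m)) (allFin m)

countVecs : ∀ n m → (Vec (Fin m) n → Bool) → ℕ
countVecs n m p = length (filterᵇ p (allVecs n m))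

allᵇ : ∀ {A : Set} → (A → Bool) → List A → Bool
allᵇ p = foldr (λ x b → p x ∧ b) true

eqᵇ : ∀ {k} → Fin k → Fin k → Bool
eqᵇ x y = does (x ≟ y)

isProper : ∀ {n m} → Graph n → Vec (Fin m) n → Bool
isProper {n} G c =
  allᵇ (λ u → allᵇ (λ v → not (adj G u v ∧ eqᵇ (lookup c u) (lookup c v))) (allFin n)) (allFin n)

P : ∀ {n} → Graph n → ℕ → ℕ
P {n} G m = countVecs n m (isProper G)

-- An m-fold cover of G.  Up to isomorphism V(H) = V(G) × [m] with L(u) = {u} × [m];
-- hadj u i v j says (u,i) and (v,j) are adjacent in H.
record Cover {n : ℕ} (G : Graph n) (m : ℕ) : Set where
  field
    hadj     : Fin n → Fin m → Fin n → Fin m → Bool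
    hsym     : ∀ u i v j → hadj u i v j ≡ hadj v j u i
    hirrefl  : ∀ u i → hadj u i u i ≡ false
    complete : ∀ u i j → i ≢ j → hadj u i u j ≡ true
    over     : ∀ u v i j → u ≢ v → hadj u i v j ≡ true → adj G u v ≡ true
    matching : ∀ u v i j k → u ≢ v → hadj u i v j ≡ true → hadj u i v k ≡ true → j ≡ k
open Cover public

isHColoring : ∀ {n m} {G : Graph n} → Cover G m → Vec (Fin m) n → Bool
isHColoring {n} H c =
  allᵇ (λ u → allᵇ (λ v → eqᵇ u v ∨ not (hadj H u (lookup c u) v (lookup c v))) (allFin n)) (allFin n)

PDPcover : ∀ {n m} {G : Graph n} → Cover G m → ℕ
PDPcover {n} {m} H = countVecs n m (isHColoring H)

IsPDP : ∀ {n} → Graph n → ℕ → ℕ → Set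
IsPDP G m d = (Σ (Cover G m) λ H → PDPcover H ≡ d) × (∀ (H : Cover G m) → d ≤ PDPcover H)

{-# OPTIONS --safe #-}

-- Extend the matchings of a cover to bijections σ(u,v); this only destroys colourings.  Expand both
-- counts by inclusion–exclusion over sets A of violated edges: N(A) for the cover, N₀(A) for ordinary
-- colourings.  Contracting the edges of A one at a time eliminates one colour variable per non-loop,
-- so N(A) = N₀(A) = m^(n-|A|) if A is a forest and N(A) ≤ N₀(A) always; hence sets A of odd size can
-- only help.  If |A| is even, then |A| ≠ g: for |A| < g the set A is a forest, since a loop would
-- close a cycle of length < g, and for |A| > g it contains a forest with g edges, so that
-- N₀(A) ≤ m^(n-g).  Summing over A bounds the difference by 2^|E(G)| m^(n-g).  Every graph is free
-- of cycles shorter than 3, which gives the second part.  All bounds are multiplied by m^g, so that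
-- no exponent n - g has to be formed.
module Submission where

open import Defs
open import Data.Nat using (ℕ; zero; suc; _+_; _≤_; _<_; _*_; _∸_; _^_; ∣_-_∣; z≤n; s≤s)
open import Data.Nat.ListAction using (sum)
open import Data.Nat.ListAction.Properties using (sum-++)
open import Data.Nat.Properties hiding (_≟_; suc-injective)
open import Data.Nat.Tactic.RingSolver using (solve-∀)
open import Data.Bool using (Bool; true; false; not; _∧_; _∨_; if_then_else_)
open import Data.Bool.Properties using (∧-identityʳ) renaming (_≟_ to _≟ᵇ_)
open import Data.Fin using (Fin; zero; suc; toℕ; inject₁; fromℕ; _≟_; punchIn; punchOut)
open import Data.Fin.Properties using (punchIn-punchOut; punchIn-injective; punchOut-injective; punchOut-cong; injective⇒≤; any?; suc-injective; toℕ-inject₁; toℕ-injective)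
open import Data.Fin.Permutation using (Permutation′; _⟨$⟩ʳ_; _⟨$⟩ˡ_; flip; _∘ₚ_; insert; insert-punchIn; inverseˡ; inverseʳ)
  renaming (id to idₚ)
open import Data.List using (List; []; _∷_; _++_; map; concatMap; allFin; cartesianProduct; filter; filterᵇ; length)
open import Data.List.Properties using (map-++; map-cong; map-∘; map-tabulate; length-tabulate)
open import Data.List.Membership.Propositional using (_∈_; _∉_)
open import Data.List.Membership.Propositional.Properties using (∈-filter⁺; ∈-cartesianProduct⁺; ∈-allFin)
open import Data.List.Membership.Setoid.Properties using (index-injective)
open import Data.List.Relation.Binary.Sublist.Propositional using (_⊆_; []; _∷_; _∷ʳ_; minimum; ⊆-refl) renaming (lookup to ⊆-lookup)
open import Data.List.Relation.Binary.Sublist.Propositional.Properties using (All-resp-⊆)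
open import Data.List.Relation.Unary.All as All using (All; []; _∷_)
open import Data.List.Relation.Unary.All.Properties using (all-filter)
open import Data.List.Relation.Unary.AllPairs using ([]; _∷_)
open import Data.List.Relation.Unary.Unique.Propositional using (Unique)
open import Data.List.Relation.Unary.Unique.Propositional.Properties using (filter⁺; cartesianProduct⁺; allFin⁺)
open import Relation.Binary.Definitions using (tri<; tri≈; tri>)
open import Relation.Binary.Core using (Rel)
open import Relation.Binary.Construct.Closure.Equivalence as Eq using (EqClosure)
open import Relation.Binary.Construct.Closure.ReflexiveTransitive using (Star; ε; _◅_; _◅◅_)
open import Relation.Binary.Construct.Closure.Symmetric using (SymClosure; fwd; bwd)
open import Function.Definitions using (Injective)
open import Data.List.Relation.Unary.Any using (here; there; index)
open import Data.Vec using (Vec; []; _∷_; lookup; insertAt)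
open import Data.Vec.Properties using (insertAt-lookup; insertAt-punchIn)
open import Data.Product using (Σ; _×_; _,_; proj₁; proj₂; ∃-syntax)
open import Data.Sum using (_⊎_; inj₁; inj₂)
open import Data.Empty using (⊥; ⊥-elim)
open import Function using (_∘_; id; case_of_)
open import Level using (0ℓ)
open import Relation.Nullary using (¬_; Dec; yes; no; contradiction)
open import Relation.Nullary.Decidable using (dec-true; dec-false; decidable-stable; _×-dec_; ¬?)
open import Relation.Binary.PropositionalEquality using (_≡_; _≢_; refl; trans; cong; cong₂; subst; subst₂; setoid; module ≡-Reasoning)
  renaming (sym to ≡sym)

private variable
  A B : Set
  k m n : ℕ

-- Counting

∑ : List A → (A → ℕ) → ℕ
∑ xs f = sum (map f xs)

∑-cong : ∀ {f g : A → ℕ} (xs : List A) → (∀ x → f x ≡ g x) → ∑ xs f ≡ ∑ xs g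
∑-cong xs f≗g = cong sum (map-cong f≗g xs)

∑-mono : ∀ {f g : A → ℕ} (xs : List A) → (∀ x → f x ≤ g x) → ∑ xs f ≤ ∑ xs g
∑-mono []       f≤g = z≤n
∑-mono (x ∷ xs) f≤g = +-mono-≤ (f≤g x) (∑-mono xs f≤g)

+-interchange : ∀ a b c d → (a + b) + (c + d) ≡ (a + c) + (b + d)
+-interchange = solve-∀

∑-+ : ∀ (xs : List A) (f g : A → ℕ) → ∑ xs (λ x → f x + g x) ≡ ∑ xs f + ∑ xs g
∑-+ []       f g = refl
∑-+ (x ∷ xs) f g =
  trans (cong (f x + g x +_) (∑-+ xs f g)) (+-interchange (f x) (g x) (∑ xs f) (∑ xs g))

∑-const : ∀ (xs : List A) c → ∑ xs (λ _ → c) ≡ length xs * c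
∑-const []       c = refl
∑-const (x ∷ xs) c = cong (c +_) (∑-const xs c)

∑-zero : ∀ (xs : List A) → ∑ xs (λ _ → 0) ≡ 0
∑-zero xs = trans (∑-const xs 0) (*-zeroʳ (length xs))

∑-swap : ∀ (xs : List A) (ys : List B) (f : A → B → ℕ) →
         ∑ xs (λ x → ∑ ys (f x)) ≡ ∑ ys (λ y → ∑ xs (λ x → f x y))
∑-swap []       ys f = ≡sym (∑-zero ys)
∑-swap (x ∷ xs) ys f =
  trans (cong (∑ ys (f x) +_) (∑-swap xs ys f)) (≡sym (∑-+ ys (f x) _))

∑-concatMap : ∀ (g : A → List B) (xs : List A) (f : B → ℕ) →
              ∑ (concatMap g xs) f ≡ ∑ xs (λ x → ∑ (g x) f)
∑-concatMap g []       f = refl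
∑-concatMap g (x ∷ xs) f = begin
  sum (map f (g x ++ concatMap g xs))   ≡⟨ cong sum (map-++ f (g x) _) ⟩
  sum (map f (g x) ++ map f (concatMap g xs)) ≡⟨ sum-++ (map f (g x)) _ ⟩
  ∑ (g x) f + ∑ (concatMap g xs) f      ≡⟨ cong (∑ (g x) f +_) (∑-concatMap g xs f) ⟩
  ∑ (g x) f + ∑ xs (λ x → ∑ (g x) f)    ∎
  where open ≡-Reasoning

∑-allFin-suc : ∀ (f : Fin (suc m) → ℕ) → ∑ (allFin (suc m)) f ≡ f zero + ∑ (allFin m) (f ∘ suc)
∑-allFin-suc f = cong (λ xs → f zero + sum xs)
  (trans (map-tabulate suc f) (≡sym (map-tabulate id (f ∘ suc))))

∑-allVecs-suc : ∀ n m (f : Vec (Fin m) (suc n) → ℕ) →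
  ∑ (allVecs (suc n) m) f ≡ ∑ (allFin m) (λ c → ∑ (allVecs n m) (λ w → f (c ∷ w)))
∑-allVecs-suc n m f = trans (∑-concatMap _ (allFin m) f)
  (∑-cong (allFin m) (λ c → cong sum (≡sym (map-∘ (allVecs n m)))))

-- The position `j` is arbitrary because a contraction may eliminate the colour of any vertex. The
-- induction step exchanges the sum over the first coordinate with the one over coordinate `j`.
∑-insertAt : ∀ n m (j : Fin (suc n)) (f : Vec (Fin m) (suc n) → ℕ) →
  ∑ (allVecs (suc n) m) f ≡ ∑ (allFin m) (λ c → ∑ (allVecs n m) (λ w → f (insertAt w j c)))
∑-insertAt n       m zero    f = ∑-allVecs-suc n m f
∑-insertAt (suc n) m (suc j) f = begin
  ∑ (allVecs (2 + n) m) f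
    ≡⟨ ∑-allVecs-suc (suc n) m f ⟩
  ∑ cs (λ a → ∑ (allVecs (suc n) m) (λ w → f (a ∷ w)))
    ≡⟨ ∑-cong cs (λ a → ∑-insertAt n m j (λ w → f (a ∷ w))) ⟩
  ∑ cs (λ a → ∑ cs (λ c → ∑ ws (λ w → f (a ∷ insertAt w j c))))
    ≡⟨ ∑-swap cs cs _ ⟩
  ∑ cs (λ c → ∑ cs (λ a → ∑ ws (λ w → f (a ∷ insertAt w j c))))
    ≡⟨ ∑-cong cs (λ c → ∑-allVecs-suc n m (λ w → f (insertAt w (suc j) c))) ⟨
  ∑ cs (λ c → ∑ (allVecs (suc n) m) (λ w → f (insertAt w (suc j) c))) ∎
  where
  open ≡-Reasoning
  cs = allFin m
  ws = allVecs n m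

𝟙 : Bool → ℕ
𝟙 b = if b then 1 else 0

𝟙-mono : ∀ b c → (b ≡ true → c ≡ true) → 𝟙 b ≤ 𝟙 c
𝟙-mono false c b⇒c = z≤n
𝟙-mono true  c b⇒c rewrite b⇒c refl = ≤-refl

∑-eqᵇ : ∀ (x : Fin m) (q : Fin m → Bool) → ∑ (allFin m) (λ c → 𝟙 (eqᵇ x c ∧ q c)) ≡ 𝟙 (q x)
∑-eqᵇ {suc m} zero q = trans (∑-allFin-suc {m} (λ c → 𝟙 (eqᵇ zero c ∧ q c)))
  (trans (cong (𝟙 (q zero) +_) (∑-zero (allFin m))) (+-identityʳ _))
∑-eqᵇ {suc m} (suc x) q = trans (∑-allFin-suc {m} (λ c → 𝟙 (eqᵇ (suc x) c ∧ q c))) (∑-eqᵇ x (q ∘ suc))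

length-filterᵇ : ∀ (p : A → Bool) xs → length (filterᵇ p xs) ≡ ∑ xs (𝟙 ∘ p)
length-filterᵇ p [] = refl
length-filterᵇ p (x ∷ xs) with p x
... | true  = cong suc (length-filterᵇ p xs)
... | false = length-filterᵇ p xs

countVecs≡∑ : ∀ n m p → countVecs n m p ≡ ∑ (allVecs n m) (𝟙 ∘ p)
countVecs≡∑ n m p = length-filterᵇ p (allVecs n m)

countVecs-cong : ∀ {p q : Vec (Fin m) n → Bool} → (∀ c → p c ≡ q c) → countVecs n m p ≡ countVecs n m q
countVecs-cong {m} {n} {p} {q} p≗q = trans (countVecs≡∑ n m p)
  (trans (∑-cong (allVecs n m) (λ c → cong 𝟙 (p≗q c))) (≡sym (countVecs≡∑ n m q)))

countVecs-mono : ∀ {p q : Vec (Fin m) n → Bool} → (∀ c → p c ≡ true → q c ≡ true) →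
                 countVecs n m p ≤ countVecs n m q
countVecs-mono {m} {n} {p} {q} p⇒q = subst₂ _≤_ (≡sym (countVecs≡∑ n m p)) (≡sym (countVecs≡∑ n m q))
  (∑-mono (allVecs n m) (λ c → 𝟙-mono (p c) (q c) (p⇒q c)))

countVecs-split : ∀ {p q r : Vec (Fin m) n → Bool} → (∀ c → 𝟙 (p c) + 𝟙 (q c) ≡ 𝟙 (r c)) →
                  countVecs n m p + countVecs n m q ≡ countVecs n m r
countVecs-split {m} {n} {p} {q} {r} eq = begin
  countVecs n m p + countVecs n m q  ≡⟨ cong₂ _+_ (countVecs≡∑ n m p) (countVecs≡∑ n m q) ⟩
  ∑ ws (𝟙 ∘ p) + ∑ ws (𝟙 ∘ q)        ≡⟨ ∑-+ ws (𝟙 ∘ p) (𝟙 ∘ q) ⟨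
  ∑ ws (λ c → 𝟙 (p c) + 𝟙 (q c))     ≡⟨ ∑-cong ws eq ⟩
  ∑ ws (𝟙 ∘ r)                       ≡⟨ countVecs≡∑ n m r ⟨
  countVecs n m r                    ∎
  where
  open ≡-Reasoning
  ws = allVecs n m

countVecs-true : ∀ n m → countVecs n m (λ _ → true) ≡ m ^ n
countVecs-true n m = trans (countVecs≡∑ n m _) (go n)
  where
  go : ∀ n → ∑ (allVecs n m) (λ _ → 1) ≡ m ^ n
  go zero    = refl
  go (suc n) = begin
    ∑ (allVecs (suc n) m) (λ _ → 1)                 ≡⟨ ∑-allVecs-suc n m _ ⟩
    ∑ (allFin m) (λ _ → ∑ (allVecs n m) (λ _ → 1))  ≡⟨ ∑-const (allFin m) _ ⟩
    length (allFin m) * ∑ (allVecs n m) (λ _ → 1)   ≡⟨ cong₂ _*_ (length-tabulate {n = m} id) (go n) ⟩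
    m * m ^ n ∎
    where open ≡-Reasoning

-- Once the other coordinates are fixed, exactly one value at `j` passes the test, so the sum over
-- that coordinate collapses to a single term.
countVecs-eliminate : ∀ {i j : Fin (suc n)} (j≢i : j ≢ i) (φ : Fin m → Fin m) (q : Vec (Fin m) (suc n) → Bool) →
  countVecs (suc n) m (λ w → eqᵇ (φ (lookup w i)) (lookup w j) ∧ q w)
    ≡ countVecs n m (λ w → q (insertAt w j (φ (lookup w (punchOut j≢i)))))
countVecs-eliminate {n} {m} {i} {j} j≢i φ q = begin
  countVecs (suc n) m p
    ≡⟨ countVecs≡∑ (suc n) m p ⟩
  ∑ (allVecs (suc n) m) (𝟙 ∘ p)
    ≡⟨ ∑-insertAt n m j (𝟙 ∘ p) ⟩
  ∑ cs (λ c → ∑ ws (λ w → 𝟙 (p (insertAt w j c))))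
    ≡⟨ ∑-swap cs ws _ ⟩
  ∑ ws (λ w → ∑ cs (λ c → 𝟙 (p (insertAt w j c))))
    ≡⟨ ∑-cong ws (λ w → ∑-cong cs (λ c → cong₂ (λ x y → 𝟙 (eqᵇ (φ x) y ∧ q (insertAt w j c)))
         (lookup-i w c) (insertAt-lookup w j c))) ⟩
  ∑ ws (λ w → ∑ cs (λ c → 𝟙 (eqᵇ (φ (lookup w i′)) c ∧ q (insertAt w j c))))
    ≡⟨ ∑-cong ws (λ w → ∑-eqᵇ (φ (lookup w i′)) (λ c → q (insertAt w j c))) ⟩
  ∑ ws (λ w → 𝟙 (q (insertAt w j (φ (lookup w i′)))))
    ≡⟨ countVecs≡∑ n m _ ⟨
  countVecs n m (λ w → q (insertAt w j (φ (lookup w i′)))) ∎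
  where
  open ≡-Reasoning
  i′ = punchOut j≢i
  cs = allFin m
  ws = allVecs n m
  p : Vec (Fin m) (suc n) → Bool
  p w = eqᵇ (φ (lookup w i)) (lookup w j) ∧ q w
  lookup-i : ∀ w c → lookup (insertAt w j c) i ≡ lookup w i′
  lookup-i w c = trans (cong (lookup (insertAt w j c)) (≡sym (punchIn-punchOut j≢i)))
                       (insertAt-punchIn w j c i′)

eqᵇ-refl : ∀ (x : Fin k) → eqᵇ x x ≡ true
eqᵇ-refl x = dec-true (x ≟ x) refl

eqᵇ⇒≡ : ∀ (x y : Fin k) → eqᵇ x y ≡ true → x ≡ y
eqᵇ⇒≡ x y eq with x ≟ y
... | yes x≡y = x≡y

eqᵇ-transpose : ∀ (π : Permutation′ k) x y → eqᵇ x (π ⟨$⟩ʳ y) ≡ eqᵇ (π ⟨$⟩ˡ x) y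
eqᵇ-transpose π x y with x ≟ (π ⟨$⟩ʳ y) | (π ⟨$⟩ˡ x) ≟ y
... | yes _  | yes _  = refl
... | no _   | no _   = refl
... | yes eq | no neq = contradiction (trans (cong (π ⟨$⟩ˡ_) eq) (inverseˡ π)) neq
... | no neq | yes eq = contradiction (trans (≡sym (inverseʳ π)) (cong (π ⟨$⟩ʳ_) eq)) neq

∧-true : ∀ {a b} → a ∧ b ≡ true → a ≡ true × b ≡ true
∧-true {true} {true} _ = refl , refl

allᵇ-cong : ∀ {p q : A → Bool} (xs : List A) → (∀ x → p x ≡ q x) → allᵇ p xs ≡ allᵇ q xs
allᵇ-cong []       p≗q = refl
allᵇ-cong (x ∷ xs) p≗q = cong₂ _∧_ (p≗q x) (allᵇ-cong xs p≗q)

allᵇ⁺ : ∀ {p : A → Bool} (xs : List A) → (∀ {x} → x ∈ xs → p x ≡ true) → allᵇ p xs ≡ true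
allᵇ⁺ []       ps = refl
allᵇ⁺ (x ∷ xs) ps = cong₂ _∧_ (ps (here refl)) (allᵇ⁺ xs (ps ∘ there))

allᵇ⁻ : ∀ {p : A → Bool} (xs : List A) → allᵇ p xs ≡ true → ∀ {x} → x ∈ xs → p x ≡ true
allᵇ⁻ (x ∷ xs) eq (here refl) = proj₁ (∧-true eq)
allᵇ⁻ (x ∷ xs) eq (there x∈)  = allᵇ⁻ xs (proj₂ (∧-true eq)) x∈

-- Contraction of edges

Edge : ℕ → Set
Edge n = Fin n × Fin n

-- A map r : Fin n → Fin k sends each vertex to its image after the contraction of some edges.
module _ {n k} (r : Fin n → Fin (suc k)) {u v : Fin n} (v≢u : r v ≢ r u) where

  -- Contracting `uv` deletes the index `r v`; the class of `v` takes over the new index of the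
  -- class of `u`.
  merge : Fin n → Fin k
  merge x with r v ≟ r x
  ... | yes _   = punchOut v≢u
  ... | no  v≢x = punchOut v≢x

  merge-cong : ∀ {x y} → r x ≡ r y → merge x ≡ merge y
  merge-cong {x} {y} eq with r v ≟ r x | r v ≟ r y
  ... | yes _ | yes _ = refl
  ... | no  _ | no  _ = punchOut-cong (r v) eq
  ... | yes p | no  q = contradiction (trans p eq) q
  ... | no  p | yes q = contradiction (trans q (≡sym eq)) p

  merge-ends : merge u ≡ merge v
  merge-ends with r v ≟ r u | r v ≟ r v
  ... | yes p | _     = contradiction p v≢u
  ... | no  p | no  q = contradiction refl q
  ... | no  p | yes _ = punchOut-cong (r v) refl

  merge-≡ : ∀ {x y} → merge x ≡ merge y →
            r x ≡ r y ⊎ (r x ≡ r u × r y ≡ r v) ⊎ (r x ≡ r v × r y ≡ r u)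
  merge-≡ {x} {y} eq with r v ≟ r x | r v ≟ r y
  ... | yes p | yes q = inj₁ (trans (≡sym p) q)
  ... | no  p | no  q = inj₁ (punchOut-injective p q eq)
  ... | yes p | no  q = inj₂ (inj₂ (≡sym p , ≡sym (punchOut-injective v≢u q eq)))
  ... | no  p | yes q = inj₂ (inj₁ (punchOut-injective p v≢u eq , ≡sym q))

-- No edge of the list is a loop once r and the edges before it have been contracted.
data Forest {n} : ∀ {k} → (Fin n → Fin k) → List (Edge n) → Set where
  []  : ∀ {k} {r : Fin n → Fin k} → Forest r []
  _∷_ : ∀ {k} {r : Fin n → Fin (suc k)} {u v F} (v≢u : r v ≢ r u) →
        Forest (merge r v≢u) F → Forest r ((u , v) ∷ F)

module _ {n m : ℕ} (σ : Fin n → Fin n → Permutation′ m) where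

  -- `w` colours the contracted vertices, and `τ x` translates the colour of the class of `x` into
  -- that of `x`: inside a contracted tree of violated edges one colour determines all others.
  colour : (Fin n → Permutation′ m) → (Fin n → Fin k) → Vec (Fin m) k → Fin n → Fin m
  colour τ r w x = τ x ⟨$⟩ʳ lookup w (r x)

  -- With `σ u v` read as the matching between the fibres of `u` and `v`, the two chosen elements
  -- are partners.
  violates : (Fin n → Fin m) → Edge n → Bool
  violates c (u , v) = eqᵇ (σ u v ⟨$⟩ʳ c u) (c v)

  #violating : (Fin n → Permutation′ m) → (Fin n → Fin k) → List (Edge n) → ℕ
  #violating {k} τ r F = countVecs k m (λ w → allᵇ (violates (colour τ r w)) F)

  module _ {k} (τ : Fin n → Permutation′ m) (r : Fin n → Fin (suc k)) {u v : Fin n} (v≢u : r v ≢ r u) where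

    -- The colour that the class of `v` must have for `uv` to be violated, as a function of the
    -- colour of the class of `u`.
    transfer : Permutation′ m
    transfer = (τ u ∘ₚ σ u v) ∘ₚ flip (τ v)

    -- Vertices in the class of `v` now read their colour from the class of `u`, so their
    -- translation first passes through `transfer`.
    twist : Fin n → Permutation′ m
    twist x with r v ≟ r x
    ... | yes _ = transfer ∘ₚ τ x
    ... | no  _ = τ x

    colour-merge : ∀ w x →
      colour τ r (insertAt w (r v) (transfer ⟨$⟩ʳ lookup w (punchOut v≢u))) x
        ≡ colour twist (merge r v≢u) w x
    colour-merge w x with r v ≟ r x
    ... | yes v≡x = cong (τ x ⟨$⟩ʳ_)
          (trans (cong (lookup (insertAt w (r v) _)) (≡sym v≡x)) (insertAt-lookup w (r v) _))
    ... | no  v≢x = cong (τ x ⟨$⟩ʳ_)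
          (trans (cong (lookup (insertAt w (r v) _)) (≡sym (punchIn-punchOut v≢x))) (insertAt-punchIn w (r v) _ _))

    -- The condition on `uv` is solved for the colour of the class of `v`, and that variable is then
    -- eliminated.
    #violating-merge : ∀ F → #violating τ r ((u , v) ∷ F) ≡ #violating twist (merge r v≢u) F
    #violating-merge F = begin
      #violating τ r ((u , v) ∷ F)
        ≡⟨ countVecs-cong (λ w → cong (_∧ allᵇ (violates (colour τ r w)) F) (eqᵇ-transpose (τ v) _ _)) ⟩
      countVecs (suc k) m (λ w → eqᵇ (transfer ⟨$⟩ʳ lookup w (r u)) (lookup w (r v)) ∧ allᵇ (violates (colour τ r w)) F)
        ≡⟨ countVecs-eliminate v≢u (transfer ⟨$⟩ʳ_) (λ w → allᵇ (violates (colour τ r w)) F) ⟩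
      countVecs k m (λ w → allᵇ (violates (colour τ r (insertAt w (r v) (transfer ⟨$⟩ʳ lookup w (punchOut v≢u))))) F)
        ≡⟨ countVecs-cong (λ w → allᵇ-cong F (λ (a , b) →
             cong₂ (λ x y → eqᵇ (σ a b ⟨$⟩ʳ x) y) (colour-merge w a) (colour-merge w b))) ⟩
      #violating twist (merge r v≢u) F ∎
      where open ≡-Reasoning

  -- Every edge of a forest costs one of the `k` free colour variables when it is contracted.
  #violating-forest : ∀ τ {r : Fin n → Fin k} {F} → Forest r F → #violating τ r F * m ^ length F ≡ m ^ k
  #violating-forest {k} τ [] = trans (*-identityʳ _) (countVecs-true k m)
  #violating-forest {suc k} τ {r} {(u , v) ∷ F} (v≢u ∷ forest) = begin
    #violating τ r ((u , v) ∷ F) * (m * m ^ length F)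
      ≡⟨ cong (_* (m * m ^ length F)) (#violating-merge τ r v≢u F) ⟩
    N * (m * m ^ length F)   ≡⟨ x*[y*z] N m (m ^ length F) ⟩
    m * (N * m ^ length F)   ≡⟨ cong (m *_) (#violating-forest (twist τ r v≢u) forest) ⟩
    m * m ^ k                ∎
    where
    open ≡-Reasoning
    N = #violating (twist τ r v≢u) (merge r v≢u) F
    x*[y*z] : ∀ x y z → x * (y * z) ≡ y * (x * z)
    x*[y*z] = solve-∀

untwisted : Fin n → Fin n → Permutation′ m
untwisted _ _ = idₚ

-- An edge that has become a loop may kill colourings for σ but imposes nothing when σ is trivial.
#violating-≤ : ∀ (σ : Fin n → Fin n → Permutation′ m) (τ τ₀ : Fin n → Permutation′ m) →
  (∀ x i → τ₀ x ⟨$⟩ʳ i ≡ i) → ∀ (r : Fin n → Fin k) F →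
  #violating σ τ r F ≤ #violating untwisted τ₀ r F
#violating-≤ σ τ τ₀ τ₀≗id r [] = ≤-refl
#violating-≤ {k = zero} σ τ τ₀ τ₀≗id r ((u , v) ∷ F) with () ← r u
#violating-≤ {n} {m} {suc k} σ τ τ₀ τ₀≗id r ((u , v) ∷ F) with r v ≟ r u
... | no v≢u = begin
  #violating σ τ r ((u , v) ∷ F)                               ≡⟨ #violating-merge σ τ r v≢u F ⟩
  #violating σ (twist σ τ r v≢u) (merge r v≢u) F               ≤⟨ #violating-≤ σ (twist σ τ r v≢u) (twist untwisted τ₀ r v≢u) twist-id (merge r v≢u) F ⟩
  #violating untwisted (twist untwisted τ₀ r v≢u) (merge r v≢u) F ≡⟨ #violating-merge untwisted τ₀ r v≢u F ⟨
  #violating untwisted τ₀ r ((u , v) ∷ F)                      ∎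
  where
  open ≤-Reasoning
  transfer-id : ∀ i → transfer untwisted τ₀ r v≢u ⟨$⟩ʳ i ≡ i
  transfer-id i = trans (cong (τ₀ v ⟨$⟩ˡ_) (trans (τ₀≗id u i) (≡sym (τ₀≗id v i)))) (inverseˡ (τ₀ v))
  twist-id : ∀ x i → twist untwisted τ₀ r v≢u x ⟨$⟩ʳ i ≡ i
  twist-id x i with r v ≟ r x
  ... | yes _ = trans (τ₀≗id x _) (transfer-id i)
  ... | no  _ = τ₀≗id x i
... | yes v≡u = begin
  #violating σ τ r ((u , v) ∷ F)           ≤⟨ countVecs-mono {m} {suc k} (λ w eq → proj₂ (∧-true {violates σ (colour σ τ r w) (u , v)} eq)) ⟩
  #violating σ τ r F                       ≤⟨ #violating-≤ σ τ τ₀ τ₀≗id r F ⟩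
  #violating untwisted τ₀ r F              ≤⟨ countVecs-mono (λ w eq → cong₂ _∧_ (loop w) eq) ⟩
  #violating untwisted τ₀ r ((u , v) ∷ F)  ∎
  where
  open ≤-Reasoning
  loop : ∀ w → eqᵇ (τ₀ u ⟨$⟩ʳ lookup w (r u)) (τ₀ v ⟨$⟩ʳ lookup w (r v)) ≡ true
  loop w rewrite τ₀≗id u (lookup w (r u)) | τ₀≗id v (lookup w (r v)) | v≡u = eqᵇ-refl (lookup w (r u))

-- Short cycles

-- The number `l` counts edges, so a closing edge turns a path into a cycle of length `suc l`.
record Path {n} (R : Rel (Fin n) 0ℓ) (l : ℕ) (x y : Fin n) : Set where
  field
    vertex    : Fin (suc l) → Fin n
    injective : Injective _≡_ _≡_ vertex
    start     : vertex zero ≡ x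
    end       : vertex (fromℕ l) ≡ y
    step      : ∀ i → R (vertex (inject₁ i)) (vertex (suc i))
open Path

module _ {R : Rel (Fin n) 0ℓ} where

  suffix : ∀ {l x y} (p : Path R l x y) i → ∃[ l′ ] Path R l′ (vertex p i) y
  suffix {l} p zero = l , record
    { vertex = vertex p ; injective = injective p ; start = refl ; end = end p ; step = step p }
  suffix {suc l} p (suc i) = suffix (record
    { vertex = vertex p ∘ suc ; injective = λ eq → suc-injective (injective p eq)
    ; start = refl ; end = end p ; step = step p ∘ suc }) i

  -- Loop erasure: if the new first vertex already lies on the path, the path is cut down to the
  -- part from there on.
  simplePath : ∀ {x y} → Star R x y → ∃[ l ] Path R l x y
  simplePath {x} ε = 0 , record
    { vertex = λ _ → x ; injective = λ { {zero} {zero} _ → refl } ; start = refl ; end = refl ; step = λ () }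
  simplePath {x} (x~z ◅ z⋆y) with simplePath z⋆y
  ... | l , p with any? (λ i → vertex p i ≟ x)
  ... | yes (i , refl) = suffix p i
  ... | no x∉p = suc l , record
    { vertex = vs ; injective = vs-injective ; start = refl ; end = end p ; step = vs-step }
    where
    vs : Fin (2 + l) → Fin _
    vs zero    = x
    vs (suc i) = vertex p i
    vs-injective : Injective _≡_ _≡_ vs
    vs-injective {zero}  {zero}  eq = refl
    vs-injective {zero}  {suc j} eq = contradiction (j , ≡sym eq) x∉p
    vs-injective {suc i} {zero}  eq = contradiction (i , eq) x∉p
    vs-injective {suc i} {suc j} eq = cong suc (injective p eq)
    vs-step : ∀ i → R (vs (inject₁ i)) (vs (suc i))
    vs-step zero    = subst (R x) (≡sym (start p)) x~z
    vs-step (suc i) = step p i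

Link : List (Edge n) → Rel (Fin n) 0ℓ
Link F x y = (x , y) ∈ F

position : ∀ {F : List (Edge n)} {x y} → SymClosure (Link F) x y → Fin (length F)
position (fwd e) = index e
position (bwd e) = index e

position-injective : ∀ {F : List (Edge n)} {x y x′ y′} (e : SymClosure (Link F) x y) (e′ : SymClosure (Link F) x′ y′) →
  position e ≡ position e′ → (x ≡ x′ × y ≡ y′) ⊎ (x ≡ y′ × y ≡ x′)
position-injective (fwd e) (fwd e′) eq with refl ← index-injective (setoid _) e e′ eq = inj₁ (refl , refl)
position-injective (fwd e) (bwd e′) eq with refl ← index-injective (setoid _) e e′ eq = inj₂ (refl , refl)
position-injective (bwd e) (fwd e′) eq with refl ← index-injective (setoid _) e e′ eq = inj₂ (refl , refl)
position-injective (bwd e) (bwd e′) eq with refl ← index-injective (setoid _) e e′ eq = inj₁ (refl , refl)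

-- A path without repeated vertices traverses no edge twice, so its steps occupy distinct positions
-- of `F`.
path-length : ∀ {F : List (Edge n)} {l x y} → Path (SymClosure (Link F)) l x y → l ≤ length F
path-length {l = l} p = injective⇒≤ {f = λ i → position (step p i)} inj
  where
  inj : ∀ {i j} → position (step p i) ≡ position (step p j) → i ≡ j
  inj {i} {j} eq with position-injective (step p i) (step p j) eq
  ... | inj₁ (_ , eq′) = suc-injective (injective p eq′)
  -- One edge traversed in both directions would force i = j + 1 and j = i + 1.
  ... | inj₂ (eq₁ , eq₂) = contradiction (trans (≡sym (toℕ-inject₁ i)) (cong toℕ (injective p eq₁)))
        (<⇒≢ (<-trans (n<1+n (toℕ i))
          (subst (_< suc (toℕ j)) (trans (≡sym (toℕ-inject₁ j)) (cong toℕ (≡sym (injective p eq₂)))) (n<1+n (toℕ j)))))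

-- Each class of `r` is connected by edges of `F`; this supplies the walk that a loop closes to a
-- cycle.
Contracts : List (Edge n) → (Fin n → Fin k) → Set
Contracts F r = ∀ {x y} → r x ≡ r y → EqClosure (Link F) x y

contracts-merge : ∀ {F} {r : Fin n → Fin (suc k)} {u v} (v≢u : r v ≢ r u) →
                  Contracts F r → Contracts ((u , v) ∷ F) (merge r v≢u)
contracts-merge {F = F} {r} {u} {v} v≢u con {x} {y} eq with merge-≡ r v≢u eq
... | inj₁ x≡y               = Eq.map there (con x≡y)
... | inj₂ (inj₁ (x≡u , y≡v)) =
  Eq.map there (con x≡u) ◅◅ fwd (here refl) ◅ Eq.map there (con (≡sym y≡v))
... | inj₂ (inj₂ (x≡v , y≡u)) =
  Eq.map there (con x≡v) ◅◅ bwd (here refl) ◅ Eq.map there (con (≡sym y≡u))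

Unique-resp-⊆ : ∀ {xs ys : List A} → xs ⊆ ys → Unique ys → Unique xs
Unique-resp-⊆ []         []       = []
Unique-resp-⊆ (_ ∷ʳ s)   (_ ∷ u)  = Unique-resp-⊆ s u
Unique-resp-⊆ (refl ∷ s) (px ∷ u) = All-resp-⊆ s px ∷ Unique-resp-⊆ s u

-- Parallel edges and triangles after contraction

module _ (r : Fin n → Fin k) where

  Ends : Edge n → Fin k → Fin k → Set
  Ends (x , y) s t = (r x ≡ s × r y ≡ t) ⊎ (r x ≡ t × r y ≡ s)

  ends : ∀ e → Ends e (r (proj₁ e)) (r (proj₂ e))
  ends e = inj₁ (refl , refl)

  Ends-swap : ∀ e {s t} → Ends e s t → Ends e t s
  Ends-swap e (inj₁ p) = inj₂ p
  Ends-swap e (inj₂ p) = inj₁ p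

  Ends-unique : ∀ e {s t s′ t′} → Ends e s t → Ends e s′ t′ → (s ≡ s′ × t ≡ t′) ⊎ (s ≡ t′ × t ≡ s′)
  Ends-unique e (inj₁ (refl , refl)) (inj₁ (refl , refl)) = inj₁ (refl , refl)
  Ends-unique e (inj₁ (refl , refl)) (inj₂ (refl , refl)) = inj₂ (refl , refl)
  Ends-unique e (inj₂ (refl , refl)) (inj₁ (refl , refl)) = inj₂ (refl , refl)
  Ends-unique e (inj₂ (refl , refl)) (inj₂ (refl , refl)) = inj₁ (refl , refl)

forest-loopless : ∀ {r : Fin n → Fin k} {e F s t} → Forest r (e ∷ F) → Ends r e s t → s ≢ t
forest-loopless (v≢u ∷ _) (inj₁ (refl , refl)) s≡t = v≢u (≡sym s≡t)
forest-loopless (v≢u ∷ _) (inj₂ (refl , refl)) s≡t = v≢u s≡t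

-- An edge parallel to `e` becomes a loop when `e` is contracted, which a forest forbids.
forest-simple : ∀ {r : Fin n → Fin k} {e f F s t} → Forest r (e ∷ f ∷ F) → Ends r e s t → Ends r f s t → ⊥
forest-simple {r = r} {e} {f} (v≢u ∷ v′≢u′ ∷ _) Ee Ef with Ends-unique r e (ends r e) Ee
... | inj₁ (refl , refl) with Ef
...   | inj₁ (p , q) = v′≢u′ (trans (merge-cong r v≢u q) (trans (≡sym (merge-ends r v≢u)) (≡sym (merge-cong r v≢u p))))
...   | inj₂ (p , q) = v′≢u′ (trans (merge-cong r v≢u q) (trans (merge-ends r v≢u) (≡sym (merge-cong r v≢u p))))
forest-simple {r = r} {e} {f} (v≢u ∷ v′≢u′ ∷ _) Ee Ef | inj₂ (refl , refl) with Ef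
...   | inj₁ (p , q) = v′≢u′ (trans (merge-cong r v≢u q) (trans (merge-ends r v≢u) (≡sym (merge-cong r v≢u p))))
...   | inj₂ (p , q) = v′≢u′ (trans (merge-cong r v≢u q) (trans (≡sym (merge-ends r v≢u)) (≡sym (merge-cong r v≢u p))))

Triangle : (Fin n → Fin k) → Edge n → Edge n → Edge n → Set
Triangle r e f h = ∃[ s ] ∃[ t ] ∃[ z ] Ends r e s t × Ends r f t z × Ends r h s z

-- The third edge becomes a loop after the first two are contracted, but it is neither a loop before
-- nor parallel to one of them. Hence the cycle it closes uses all three edges.
triangle : ∀ {r : Fin n → Fin (2 + k)} {a a′ b b′ c c′} (p : r a′ ≢ r a) (q : merge r p b′ ≢ merge r p b) →
  Forest r ((a , a′) ∷ (c , c′) ∷ []) → Forest r ((b , b′) ∷ (c , c′) ∷ []) → r c′ ≢ r c →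
  merge (merge r p) q c′ ≡ merge (merge r p) q c → Triangle r (a , a′) (b , b′) (c , c′)
triangle {r = r} {a} {a′} {b} {b′} {c} {c′} p q αγ βγ c′≢c loop with merge-≡ (merge r p) q loop
-- Contracting the first edge alone cannot close the third one: it would be a loop or parallel to
-- the first.
... | inj₁ c′≈c = ⊥-elim (lift c′≈c)
  where
  lift : merge r p c′ ≡ merge r p c → ⊥
  lift eq with merge-≡ r p eq
  ... | inj₁ eq′ = c′≢c eq′
  ... | inj₂ (inj₁ (x , y)) = forest-simple αγ (ends r (a , a′)) (inj₂ (y , x))
  ... | inj₂ (inj₂ (x , y)) = forest-simple αγ (ends r (a , a′)) (inj₁ (y , x))
... | inj₂ between = close between
  where
  near : ∀ {x y} → merge r p x ≡ merge r p y → r x ≡ r y ⊎ Ends r (a , a′) (r x) (r y)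
  near eq with merge-≡ r p eq
  ... | inj₁ x≡y = inj₁ x≡y
  ... | inj₂ (inj₁ (x , y)) = inj₂ (inj₁ (≡sym x , ≡sym y))
  ... | inj₂ (inj₂ (x , y)) = inj₂ (inj₂ (≡sym y , ≡sym x))
  γ = (c , c′)
  complete-triangle : ∀ {x y} → Ends r (b , b′) (r x) (r y) →
    merge r p c′ ≡ merge r p x → merge r p c ≡ merge r p y → Triangle r (a , a′) (b , b′) γ
  -- Exactly one end of the third edge must reach the second edge through the first. If none or both
  -- do, the third edge is a loop or parallel to the second.
  complete-triangle {x} {y} β c′≈x c≈y with near c′≈x | near c≈y
  ... | inj₁ c′≡x | inj₁ c≡y = ⊥-elim (forest-simple βγ β (inj₂ (c≡y , c′≡x)))
  ... | inj₁ c′≡x | inj₂ α = r c , r y , r x , α , Ends-swap r (b , b′) β , inj₁ (refl , c′≡x)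
  ... | inj₂ α | inj₁ c≡y = r c′ , r x , r y , α , β , inj₂ (c≡y , refl)
  ... | inj₂ α | inj₂ α′ with Ends-unique r (a , a′) α α′
  ...   | inj₁ (c′≡c , _) = contradiction c′≡c c′≢c
  ...   | inj₂ (c′≡y , x≡c) = ⊥-elim (forest-simple βγ β (inj₁ (≡sym x≡c , c′≡y)))
  close : (merge r p c′ ≡ merge r p b × merge r p c ≡ merge r p b′) ⊎
          (merge r p c′ ≡ merge r p b′ × merge r p c ≡ merge r p b) → Triangle r (a , a′) (b , b′) γ
  close (inj₁ (x , y)) = complete-triangle {b} {b′} (ends r (b , b′)) x y
  close (inj₂ (x , y)) = complete-triangle {b′} {b} (Ends-swap r (b , b′) (ends r (b , b′))) x y

-- The third side of a triangle is determined by the other two up to parallel edges.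
triangle-unique : ∀ {r : Fin n → Fin k} {α β γ δ F₁ F₂ F₃} →
  Forest r (α ∷ F₁) → Forest r (β ∷ F₂) → Forest r (γ ∷ δ ∷ F₃) → Triangle r α β γ → Triangle r α β δ → ⊥
triangle-unique {r = r} {α} {β} fα fβ fγδ (s , t , z , αst , βtz , γsz) (s′ , t′ , z′ , αst′ , βtz′ , δsz′)
  with Ends-unique r α αst αst′ | Ends-unique r β βtz βtz′
... | inj₁ (refl , refl) | inj₁ (_ , refl)    = forest-simple fγδ γsz δsz′
... | inj₁ (refl , refl) | inj₂ (_ , z≡t)     = forest-loopless fβ βtz (≡sym z≡t)
... | inj₂ (refl , refl) | inj₁ (t≡s , _)     = forest-loopless fα αst (≡sym t≡s)
... | inj₂ (refl , refl) | inj₂ (_ , z≡s)     = forest-loopless fγδ γsz (≡sym z≡s)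

singleton-forest : ∀ {r : Fin n → Fin k} {u v} → r v ≢ r u → Forest r ((u , v) ∷ [])
singleton-forest {k = zero}  {r} {u} v≢u with () ← r u
singleton-forest {k = suc k} v≢u = v≢u ∷ []

-- If both `γ` and `δ` became loops after `α` and `β`, each would complete a triangle with these
-- two, and they would be parallel to each other.
extend-pair : ∀ {r : Fin n → Fin k} {α β γ δ} →
  Forest r (α ∷ β ∷ []) → Forest r (α ∷ γ ∷ []) → Forest r (β ∷ γ ∷ []) →
  Forest r (α ∷ δ ∷ []) → Forest r (β ∷ δ ∷ []) → Forest r (γ ∷ δ ∷ []) → r (proj₂ δ) ≢ r (proj₁ δ) →
  Forest r (α ∷ β ∷ γ ∷ []) ⊎ Forest r (α ∷ β ∷ δ ∷ [])
extend-pair {r = r} {γ = c , c′} {δ = d , d′} αβ@(p ∷ q ∷ []) αγ βγ αδ βδ γδ@(c′≢c ∷ _) d′≢d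
  with merge (merge r p) q c′ ≟ merge (merge r p) q c | merge (merge r p) q d′ ≟ merge (merge r p) q d
... | no c′≉c  | _        = inj₁ (p ∷ q ∷ singleton-forest c′≉c)
... | yes _    | no d′≉d  = inj₂ (p ∷ q ∷ singleton-forest d′≉d)
... | yes c′≈c | yes d′≈d = ⊥-elim (triangle-unique αβ βγ γδ
      (triangle p q αγ βγ c′≢c c′≈c) (triangle p q αδ βδ d′≢d d′≈d))

-- Forests in a graph without short cycles

module _ (G : Graph n) where

  -- The order of the endpoints picks one of the two orientations, so each undirected edge is
  -- counted once.
  IsEdge : Edge n → Set
  IsEdge (u , v) = adj G u v ≡ true × toℕ u < toℕ v

  -- `F` holds the edges contracted so far and `A` those still to come.
  record Extends (F A : List (Edge n)) : Set where
    field
      edgesˡ   : All IsEdge F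
      edgesʳ   : All IsEdge A
      unique   : Unique A
      disjoint : All (_∉ F) A
  open Extends

  extends-shift : ∀ {F e A} → Extends F (e ∷ A) → Extends (e ∷ F) A
  extends-shift record { edgesˡ = F-edges ; edgesʳ = pe ∷ A-edges ; unique = e∉A ∷ A-unique ; disjoint = _ ∷ A∉F } = record
    { edgesˡ   = pe ∷ F-edges
    ; edgesʳ   = A-edges
    ; unique   = A-unique
    ; disjoint = All.zipWith (λ { (e≢x , x∉F) (here x≡e) → e≢x (≡sym x≡e) ; (e≢x , x∉F) (there x∈F) → x∉F x∈F }) (e∉A , A∉F)
    }

  extends-resp-⊆ : ∀ {F A B} → B ⊆ A → Extends F A → Extends F B
  extends-resp-⊆ s ext = record
    { edgesˡ = edgesˡ ext ; edgesʳ = All-resp-⊆ s (edgesʳ ext)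
    ; unique = Unique-resp-⊆ s (unique ext) ; disjoint = All-resp-⊆ s (disjoint ext) }

  module _ {g} (no-short-cycle : ∀ j → j < g → ¬ CycleOfLength G j) where

    -- A loop `uv` would close a path of at most |F| contracted edges to a cycle of length at most
    -- |F| + 1.
    loopless : ∀ {F u v A} {r : Fin n → Fin k} → Contracts F r → Extends F ((u , v) ∷ A) →
               suc (length F) < g → r v ≢ r u
    loopless {F = F} {u} {v} con ext F<g v≡u = no-short-cycle (suc l) (≤-<-trans (s≤s (path-length p)) F<g)
      (long l p , vertex p , injective p , (λ i → adjacent (step p i)) ,
       subst₂ (λ x y → adj G x y ≡ true) (≡sym (end p)) (≡sym (start p)) (trans (sym G v u) (proj₁ uv)))
      where
      uv = All.head (edgesʳ ext)
      l = proj₁ (simplePath (con (≡sym v≡u)))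
      p = proj₂ (simplePath (con (≡sym v≡u)))
      adjacent : ∀ {x y} → SymClosure (Link F) x y → adj G x y ≡ true
      adjacent (fwd e) = proj₁ (All.lookup (edgesˡ ext) e)
      adjacent {x} {y} (bwd e) = trans (sym G x y) (proj₁ (All.lookup (edgesˡ ext) e))
      not-link : SymClosure (Link F) u v → ⊥
      not-link (fwd e) = All.head (disjoint ext) e
      not-link (bwd e) = <-asym (proj₂ uv) (proj₂ (All.lookup (edgesˡ ext) e))
      -- A cycle needs at least three edges: the endpoints differ, and `uv` is not itself in `F` in
      -- either orientation.
      long : ∀ l → Path (SymClosure (Link F)) l u v → 2 ≤ l
      long zero p = contradiction (cong toℕ (trans (≡sym (start p)) (end p))) (<⇒≢ (proj₂ uv))
      long (suc zero) p = ⊥-elim (not-link (subst₂ (SymClosure (Link F)) (start p) (end p) (step p zero)))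
      long (suc (suc l)) p = s≤s (s≤s z≤n)

    short-forest : ∀ {F A} {r : Fin n → Fin k} → Contracts F r → Extends F A → length F + length A < g → Forest r A
    short-forest {A = []} con ext F+A<g = []
    short-forest {k = zero} {A = (u , v) ∷ A} {r} con ext F+A<g with () ← r u
    short-forest {k = suc k} {F = F} {A = (u , v) ∷ A} {r} con ext F+A<g =
      v≢u ∷ short-forest (contracts-merge v≢u con) (extends-shift ext) 1+F+A<g
      where
      1+F+A<g = subst (_< g) (+-suc (length F) (length A)) F+A<g
      v≢u = loopless con ext (≤-<-trans (s≤s (m≤m+n (length F) (length A))) 1+F+A<g)

    -- Among g + 1 edges the cycle matroid cannot be uniform of rank g - 1: contracting g - 3 of
    -- them would leave U₂,₄, which is not graphic.
    long-forest : ∀ t {F A} {r : Fin n → Fin k} → Contracts F r → Extends F A →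
      3 + t + length F ≡ g → 4 + t ≤ length A → ∃[ B ] B ⊆ A × Forest r B × length B ≡ 3 + t
    long-forest {k = zero} t {A = (u , v) ∷ A} {r} con ext F≡ A≥ with () ← r u
    long-forest {k = suc k} (suc t) {F = F} {A = (u , v) ∷ A} {r} con ext F≡ (s≤s A≥) =
      let B , s , f , eq = long-forest t (contracts-merge v≢u con) (extends-shift ext)
                             (trans (+-suc (3 + t) (length F)) F≡) A≥
      in (u , v) ∷ B , refl ∷ s , v≢u ∷ f , cong suc eq
      where
      v≢u = loopless con ext (subst (suc (length F) <_) F≡ (s≤s (s≤s (m≤n+m (length F) (2 + t)))))
    long-forest zero {F = F} {α ∷ β ∷ γ ∷ δ ∷ A} {r} con ext F≡ (s≤s (s≤s (s≤s (s≤s _)))) = pick (extend-pair αβ αγ βγ αδ βδ γδ δ≢)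
      where
      pick : Forest r (α ∷ β ∷ γ ∷ []) ⊎ Forest r (α ∷ β ∷ δ ∷ []) →
             ∃[ B ] B ⊆ α ∷ β ∷ γ ∷ δ ∷ A × Forest r B × length B ≡ 3
      pick (inj₁ f) = _ , refl ∷ refl ∷ refl ∷ minimum _ , f , refl
      pick (inj₂ f) = _ , refl ∷ refl ∷ γ ∷ʳ refl ∷ minimum _ , f , refl
      -- Here `F` has g - 3 edges, so two more stay below g and any two of the four edges form a
      -- forest.
      pair : ∀ {e f} → e ∷ f ∷ [] ⊆ α ∷ β ∷ γ ∷ δ ∷ A → Forest r (e ∷ f ∷ [])
      pair s = short-forest con (extends-resp-⊆ s ext)
        (≤-reflexive (trans (cong suc (+-comm (length F) 2)) F≡))
      αβ = pair (refl ∷ refl ∷ minimum _)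
      αγ = pair (refl ∷ β ∷ʳ refl ∷ minimum _)
      αδ = pair (refl ∷ β ∷ʳ γ ∷ʳ refl ∷ minimum _)
      βγ = pair (α ∷ʳ refl ∷ refl ∷ minimum _)
      βδ = pair (α ∷ʳ refl ∷ γ ∷ʳ refl ∷ minimum _)
      γδ = pair (α ∷ʳ β ∷ʳ refl ∷ refl ∷ minimum _)
      δ≢ = forest-loopless (short-forest con (extends-resp-⊆ (α ∷ʳ β ∷ʳ γ ∷ʳ refl ∷ minimum A) ext)
        (<-trans (n<1+n _) (≤-reflexive (trans (cong (2 +_) (+-comm (length F) 1)) F≡)))) (Ends-swap r δ (ends r δ))

-- Inclusion–exclusion over the edges

module _ {n m : ℕ} (σ : Fin n → Fin n → Permutation′ m) where

  -- Colourings that violate all of `A` and nothing in `E`: this interpolates between the terms of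
  -- inclusion-exclusion (`E` empty) and the count of colourings violating no edge (`A` empty, `E`
  -- all edges).
  #mixed : List (Edge n) → List (Edge n) → ℕ
  #mixed A E = countVecs n m (λ c → allᵇ (violates σ (lookup c)) A ∧ allᵇ (not ∘ violates σ (lookup c)) E)

  #mixed-∷ : ∀ A e E → #mixed A (e ∷ E) + #mixed (e ∷ A) E ≡ #mixed A E
  #mixed-∷ A e E = countVecs-split {p = λ c → allᵇ (violates σ (lookup c)) A ∧ allᵇ (not ∘ violates σ (lookup c)) (e ∷ E)}
    (λ c → split (allᵇ (violates σ (lookup c)) A) (violates σ (lookup c) e) _)
    where
    split : ∀ a x b → 𝟙 (a ∧ (not x ∧ b)) + 𝟙 ((x ∧ a) ∧ b) ≡ 𝟙 (a ∧ b)
    split true  true  b = refl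
    split true  false b = +-identityʳ (𝟙 b)
    split false true  b = refl
    split false false b = refl

  #mixed-[] : ∀ A → #mixed A [] ≡ #violating σ (λ _ → idₚ) id A
  #mixed-[] A = countVecs-cong {q = λ c → allᵇ (violates σ (lookup c)) A} (λ c → ∧-identityʳ _)

#violating-anti : ∀ (σ : Fin n → Fin n → Permutation′ m) τ (r : Fin n → Fin k) {A B} → B ⊆ A →
                  #violating σ τ r A ≤ #violating σ τ r B
#violating-anti σ τ r {A} {B} s = countVecs-mono {p = λ w → allᵇ (violates σ (colour σ τ r w)) A}
  (λ w eq → allᵇ⁺ B (λ e∈B → allᵇ⁻ A eq (⊆-lookup s e∈B)))

Even : ℕ → Set
Even a = ∃[ j ] a ≡ 2 * j

even⇒odd : ∀ {a} → Even a → Odd (suc a)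
even⇒odd (j , eq) = j , cong suc eq

odd⇒even : ∀ {a} → Odd a → Even (suc a)
odd⇒even (j , refl) = suc j , cong suc (≡sym (+-suc j (j + 0)))

-- Since X = Z - Y, an upper bound on Z and the reverse bound on Y combine, and the errors add.
-- Adding `Y * q` to both sides avoids subtraction.
subtract-bounds : ∀ X X′ Y Y′ {Z Z′} q B → X + Y ≡ Z → X′ + Y′ ≡ Z′ →
  Z * q ≤ Z′ * q + B → Y′ * q ≤ Y * q + B → X * q ≤ X′ * q + (B + B)
subtract-bounds X X′ Y Y′ q B refl refl Z≤ Y≤ = +-cancelʳ-≤ (Y * q) _ _ (begin
  X * q + Y * q               ≡⟨ *-distribʳ-+ q X Y ⟨
  (X + Y) * q                 ≤⟨ Z≤ ⟩
  (X′ + Y′) * q + B           ≡⟨ cong (_+ B) (*-distribʳ-+ q X′ Y′) ⟩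
  X′ * q + Y′ * q + B         ≤⟨ +-monoˡ-≤ B (+-monoʳ-≤ (X′ * q) Y≤) ⟩
  X′ * q + (Y * q + B) + B    ≡⟨ rearrange (X′ * q) (Y * q) B ⟩
  X′ * q + (B + B) + Y * q    ∎)
  where
  open ≤-Reasoning
  rearrange : ∀ x y b → x + (y + b) + b ≡ x + (b + b) + y
  rearrange = solve-∀

module _ (G : Graph n) (t : ℕ) (g-odd : Odd (3 + t)) (no-short-cycle : ∀ j → j < 3 + t → ¬ CycleOfLength G j)
         (σ : Fin n → Fin n → Permutation′ m) where

  private
    q = m ^ (3 + t)
    -- An error of `m ^ n` for each of the subsets of `E` that may still join `A`.
    slack : List (Edge n) → ℕ
    slack E = 2 ^ length E * m ^ n
    σ₀ : Fin n → Fin n → Permutation′ m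
    σ₀ = untwisted
    τ₀ : Fin n → Permutation′ m
    τ₀ _ = idₚ

  contracts-id : Contracts {n = n} [] id
  contracts-id refl = ε

  -- Both counts times `m ^ length A` equal `m ^ n`; as |A| is at most g, this power is a factor of
  -- `q`.
  forest-bound : ∀ {A} → Forest id A → length A ≤ 3 + t → #violating σ₀ τ₀ id A * q ≤ #violating σ τ₀ id A * q
  forest-bound {A} forest A≤g = ≤-reflexive (trans (split (#violating σ₀ τ₀ id A)) (trans
      (cong (_* m ^ l) (trans (#violating-forest σ₀ τ₀ forest) (≡sym (#violating-forest σ τ₀ forest))))
      (≡sym (split (#violating σ τ₀ id A)))))
    where
    l = 3 + t ∸ length A
    split : ∀ x → x * q ≡ x * m ^ length A * m ^ l
    split x = trans (cong (λ y → x * m ^ y) (≡sym (m+[n∸m]≡n A≤g)))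
      (trans (cong (x *_) (^-distribˡ-+-* m (length A) l)) (≡sym (*-assoc x _ _)))

  base-bound : ∀ {A} → Extends G [] A → Even (length A) →
               #violating σ₀ τ₀ id A * q ≤ #violating σ τ₀ id A * q + m ^ n
  base-bound {A} ext A-even with <-cmp (length A) (3 + t)
  ... | tri< A<g _ _ = ≤-trans
    (forest-bound (short-forest G no-short-cycle contracts-id ext A<g) (<⇒≤ A<g)) (m≤m+n _ _)
  ... | tri≈ _ A≡g _ = contradiction
    (trans (≡sym (proj₂ A-even)) (trans A≡g (proj₂ g-odd))) (even≢odd (proj₁ A-even) (proj₁ g-odd))
  -- The whole untwisted count goes into the error, as g forest edges inside `A` already bound it by
  -- m^(n-g).
  ... | tri> _ _ A>g with long-forest G no-short-cycle t contracts-id ext (cong (3 +_) (+-identityʳ t)) A>g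
  ...   | B , B⊆A , forest , B≡g = begin
    #violating σ₀ τ₀ id A * q            ≤⟨ *-monoˡ-≤ q (#violating-anti σ₀ τ₀ id B⊆A) ⟩
    #violating σ₀ τ₀ id B * q            ≡⟨ cong (λ l → #violating σ₀ τ₀ id B * m ^ l) B≡g ⟨
    #violating σ₀ τ₀ id B * m ^ length B ≡⟨ #violating-forest σ₀ τ₀ forest ⟩
    m ^ n                                ≤⟨ m≤n+m (m ^ n) _ ⟩
    #violating σ τ₀ id A * q + m ^ n     ∎
    where open ≤-Reasoning

  -- The term of A in inclusion–exclusion carries the sign (-1)^|A|, so the inequality between the
  -- two counts alternates with the parity of |A|.
  even-bound : ∀ A E → Extends G [] A → Extends G A E → Even (length A) →
               #mixed σ₀ A E * q ≤ #mixed σ A E * q + slack E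
  odd-bound  : ∀ A E → Extends G [] A → Extends G A E → Odd (length A) →
               #mixed σ A E * q ≤ #mixed σ₀ A E * q + slack E

  extends-∷ : ∀ {A e E} → Extends G [] A → Extends G A (e ∷ E) → Extends G [] (e ∷ A)
  extends-∷ {A} {e} extA extE = record
    { edgesˡ   = []
    ; edgesʳ   = All.head (Extends.edgesʳ extE) ∷ Extends.edgesʳ extA
    ; unique   = All.tabulate (λ { x∈A refl → All.head (Extends.disjoint extE) x∈A }) ∷ Extends.unique extA
    ; disjoint = All.universal (λ _ ()) (e ∷ A)
    }

  slack-∷ : ∀ e E → slack E + slack E ≡ slack (e ∷ E)
  slack-∷ e E = trans (≡sym (*-distribʳ-+ (m ^ n) (2 ^ length E) _))
    (cong (λ x → (2 ^ length E + x) * m ^ n) (≡sym (+-identityʳ _)))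

  even-bound A [] extA _ A-even rewrite #mixed-[] σ₀ A | #mixed-[] σ A | +-identityʳ (m ^ n) =
    base-bound extA A-even
  even-bound A (e ∷ E) extA extE A-even = subst (λ s → #mixed σ₀ A (e ∷ E) * q ≤ #mixed σ A (e ∷ E) * q + s)
    (slack-∷ e E) (subtract-bounds (#mixed σ₀ A (e ∷ E)) (#mixed σ A (e ∷ E)) (#mixed σ₀ (e ∷ A) E) (#mixed σ (e ∷ A) E)
      q (slack E) (#mixed-∷ σ₀ A e E) (#mixed-∷ σ A e E)
      (even-bound A E extA (extends-resp-⊆ G (e ∷ʳ ⊆-refl) extE) A-even)
      (odd-bound (e ∷ A) E (extends-∷ extA extE) (extends-shift G extE) (even⇒odd A-even)))

  -- For odd |A| the termwise comparison has the required direction, whatever cycles `A` contains.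
  odd-bound A [] extA _ A-odd rewrite #mixed-[] σ₀ A | #mixed-[] σ A = ≤-trans
    (*-monoˡ-≤ q (#violating-≤ σ τ₀ τ₀ (λ _ _ → refl) id A)) (m≤m+n _ _)
  odd-bound A (e ∷ E) extA extE A-odd = subst (λ s → #mixed σ A (e ∷ E) * q ≤ #mixed σ₀ A (e ∷ E) * q + s)
    (slack-∷ e E) (subtract-bounds (#mixed σ A (e ∷ E)) (#mixed σ₀ A (e ∷ E)) (#mixed σ (e ∷ A) E) (#mixed σ₀ (e ∷ A) E)
      q (slack E) (#mixed-∷ σ A e E) (#mixed-∷ σ₀ A e E)
      (odd-bound A E extA (extends-resp-⊆ G (e ∷ʳ ⊆-refl) extE) A-odd)
      (even-bound (e ∷ A) E (extends-∷ extA extE) (extends-shift G extE) (odd⇒even A-odd)))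

-- Covers

-- The column is the partner of row `zero`, or an empty column if that row is empty.
free-column : ∀ (R : Fin (suc m) → Fin (suc m) → Bool) →
  (∀ {i j l} → R i j ≡ true → R i l ≡ true → j ≡ l) → (∀ {i j l} → R i l ≡ true → R j l ≡ true → i ≡ j) →
  ∃[ j ] (∀ {l} → R zero l ≡ true → l ≡ j) × (∀ {i} → R i j ≡ true → i ≡ zero)
free-column {m} R row col with any? (λ j → R zero j ≟ᵇ true)
... | yes (j , R0j) = j , (λ R0l → row R0l R0j) , (λ Rij → col Rij R0j)
... | no R0-empty with any? (λ j → ¬? (any? (λ i → R i j ≟ᵇ true)))
...   | yes (j , Rj-empty) = j , (λ R0l → contradiction (_ , R0l) R0-empty) , (λ Rij → contradiction (_ , Rij) Rj-empty)
-- Otherwise m + 1 columns would have distinct partners among the m rows other than `zero`.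
...   | no covered = contradiction (injective⇒≤ {f = λ j → punchOut (zero≢ j)} inj) (<⇒≱ (n<1+n m))
  where
  source : ∀ j → ∃[ i ] R i j ≡ true
  source j = decidable-stable (any? (λ i → R i j ≟ᵇ true)) (λ empty → covered (j , empty))
  zero≢ : ∀ j → zero ≢ proj₁ (source j)
  zero≢ j 0≡ = R0-empty (j , subst (λ i → R i j ≡ true) (≡sym 0≡) (proj₂ (source j)))
  inj : ∀ {j l} → punchOut (zero≢ j) ≡ punchOut (zero≢ l) → j ≡ l
  inj {j} {l} eq = row (proj₂ (source j))
    (subst (λ i → R i l ≡ true) (≡sym (punchOut-injective (zero≢ j) (zero≢ l) eq)) (proj₂ (source l)))

-- Row `zero` is paired with a free column, and the remaining rows and columns are matched
-- recursively.
complete-matching : ∀ (R : Fin m → Fin m → Bool) →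
  (∀ {i j l} → R i j ≡ true → R i l ≡ true → j ≡ l) → (∀ {i j l} → R i l ≡ true → R j l ≡ true → i ≡ j) →
  Σ (Permutation′ m) λ π → ∀ i {j} → R i j ≡ true → π ⟨$⟩ʳ i ≡ j
complete-matching {zero}  R row col = idₚ , λ ()
complete-matching {suc m} R row col with free-column R row col
... | j , row₀ , colⱼ = insert zero j π , extends
  where
  rest = complete-matching (λ i l → R (suc i) (punchIn j l))
    (λ p q → punchIn-injective j _ _ (row p q)) (λ p q → suc-injective (col p q))
  π = proj₁ rest
  extends : ∀ i {l} → R i l ≡ true → insert zero j π ⟨$⟩ʳ i ≡ l
  extends zero    R0l = ≡sym (row₀ R0l)
  extends (suc i) {l} Ril = begin
    insert zero j π ⟨$⟩ʳ suc i       ≡⟨ insert-punchIn zero j π i ⟩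
    punchIn j (π ⟨$⟩ʳ i)             ≡⟨ cong (punchIn j) (proj₂ rest i (subst (λ y → R (suc i) y ≡ true) (≡sym (punchIn-punchOut j≢l)) Ril)) ⟩
    punchIn j (punchOut j≢l)         ≡⟨ punchIn-punchOut j≢l ⟩
    l                                ∎
    where
    open ≡-Reasoning
    j≢l : j ≢ l
    j≢l refl with () ← colⱼ Ril

module _ {G : Graph n} (H : Cover G m) where

  -- Uniqueness of partners in the other direction is the matching condition from `v` to `u`, read
  -- through `hsym`. On the diagonal the identity is a default value.
  coverPermutation : ∀ u v → Σ (Permutation′ m) λ π → u ≢ v → ∀ i {j} → hadj H u i v j ≡ true → π ⟨$⟩ʳ i ≡ j
  coverPermutation u v with u ≟ v
  ... | yes u≡v = idₚ , λ u≢v → contradiction u≡v u≢v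
  ... | no  u≢v =
    let π , spec = complete-matching (λ i j → hadj H u i v j)
          (λ p q → matching H u v _ _ _ u≢v p q)
          (λ {i} {j} {l} p q → matching H v u l i j (u≢v ∘ ≡sym) (trans (hsym H v l u i) p) (trans (hsym H v l u j) q))
    in π , λ _ → spec

  σ[_] : Fin n → Fin n → Permutation′ m
  σ[_] u v = proj₁ (coverPermutation u v)

isEdge? : ∀ (G : Graph n) e → Dec (IsEdge G e)
isEdge? G (u , v) = (adj G u v ≟ᵇ true) ×-dec (toℕ u <? toℕ v)

edges : Graph n → List (Edge n)
edges {n} G = filter (isEdge? G) (cartesianProduct (allFin n) (allFin n))

∈-edges : ∀ (G : Graph n) {u v} → IsEdge G (u , v) → (u , v) ∈ edges G
∈-edges G {u} {v} = ∈-filter⁺ (isEdge? G) (∈-cartesianProduct⁺ (∈-allFin u) (∈-allFin v))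

extends-edges : ∀ (G : Graph n) → Extends G [] (edges G)
extends-edges {n} G = record
  { edgesˡ   = []
  ; edgesʳ   = all-filter (isEdge? G) (cartesianProduct (allFin n) (allFin n))
  ; unique   = filter⁺ (isEdge? G) (cartesianProduct⁺ (allFin⁺ n) (allFin⁺ n))
  ; disjoint = All.universal (λ _ ()) (edges G)
  }

-- For identity permutations an edge is violated exactly when it is monochromatic.
P≤#mixed : ∀ (G : Graph n) m → P G m ≤ #mixed {m = m} untwisted [] (edges G)
P≤#mixed {n} G m = countVecs-mono {p = isProper G} λ c proper → allᵇ⁺ (edges G) λ { {u , v} e → bichromatic c proper u v
  (proj₁ (All.lookup (Extends.edgesʳ (extends-edges G)) e)) }
  where
  bichromatic : ∀ (c : Vec (Fin m) n) → isProper G c ≡ true → ∀ u v → adj G u v ≡ true →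
    not (eqᵇ (lookup c u) (lookup c v)) ≡ true
  bichromatic c proper u v uv = subst (λ a → not (a ∧ eqᵇ (lookup c u) (lookup c v)) ≡ true) uv
    (allᵇ⁻ (allFin n) (allᵇ⁻ (allFin n) proper (∈-allFin u)) (∈-allFin v))

-- The bijections contain the matchings of `H`, so a colouring that avoids them also avoids the
-- cross edges of `H`.
#mixed≤PDPcover : ∀ {G : Graph n} (H : Cover G m) → #mixed σ[ H ] [] (edges G) ≤ PDPcover H
#mixed≤PDPcover {n} {m} {G} H = countVecs-mono λ c ok → allᵇ⁺ (allFin n) λ {u} _ → allᵇ⁺ (allFin n) λ {v} _ → good c ok u v
  where
  clash : ∀ (c : Vec (Fin m) n) → allᵇ (not ∘ violates σ[ H ] (lookup c)) (edges G) ≡ true →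
    ∀ u v → toℕ u < toℕ v → hadj H u (lookup c u) v (lookup c v) ≢ true
  clash c ok u v u<v h = case trans (≡sym (allᵇ⁻ (edges G) ok (∈-edges G (over H u v _ _ u≢v h , u<v)))) violated of λ ()
    where
    u≢v : u ≢ v
    u≢v u≡v = <⇒≢ u<v (cong toℕ u≡v)
    violated : not (violates σ[ H ] (lookup c) (u , v)) ≡ false
    violated = cong not (dec-true (_ ≟ _) (proj₂ (coverPermutation H u v) u≢v _ h))
  good : ∀ (c : Vec (Fin m) n) → allᵇ (not ∘ violates σ[ H ] (lookup c)) (edges G) ≡ true →
    ∀ u v → eqᵇ u v ∨ not (hadj H u (lookup c u) v (lookup c v)) ≡ true
  good c ok u v with u ≟ v | hadj H u (lookup c u) v (lookup c v) in h
  ... | yes _  | _     = refl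
  ... | no _   | false = refl
  -- `edges` lists the pair with its smaller endpoint first, so the clash is read in that
  -- orientation.
  ... | no u≢v | true with <-cmp (toℕ u) (toℕ v)
  ...   | tri< u<v _ _ = contradiction h (clash c ok u v u<v)
  ...   | tri≈ _ u≡v _ = contradiction (toℕ-injective u≡v) u≢v
  ...   | tri> _ _ v<u = contradiction (trans (hsym H v _ u _) h) (clash c ok v u v<u)

-- Ordinary colourings as colourings of a cover

eqᵇ-≢ : ∀ {x y : Fin k} → x ≢ y → eqᵇ x y ≡ false
eqᵇ-≢ {x = x} {y} = dec-false (x ≟ y)

eqᵇ-sym : ∀ (x y : Fin k) → eqᵇ x y ≡ eqᵇ y x
eqᵇ-sym x y with x ≟ y
... | yes refl = ≡sym (eqᵇ-refl x)
... | no  x≢y  = ≡sym (eqᵇ-≢ (x≢y ∘ ≡sym))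

-- Cliques as fibres and the identity matching over each edge; it shows that the DP colour function
-- is at most the chromatic polynomial.
canonicalCover : ∀ (G : Graph n) m → Cover G m
canonicalCover {n} G m = record
  { hadj     = h
  ; hsym     = λ u i v j → cong₂ _∨_ (cong₂ (λ a b → a ∧ not b) (eqᵇ-sym u v) (eqᵇ-sym i j))
                                     (cong₂ _∧_ (sym G u v) (eqᵇ-sym i j))
  ; hirrefl  = h-irrefl
  ; complete = h-complete
  ; over     = λ u v i j u≢v eq → proj₁ (h⇒ {u} {v} {i} {j} u≢v eq)
  ; matching = λ u v i j l u≢v eq eq′ → trans (≡sym (proj₂ (h⇒ {u} {v} {i} {j} u≢v eq))) (proj₂ (h⇒ {u} {v} {i} {l} u≢v eq′))
  }
  where
  h : Fin n → Fin m → Fin n → Fin m → Bool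
  h u i v j = (eqᵇ u v ∧ not (eqᵇ i j)) ∨ (adj G u v ∧ eqᵇ i j)
  h-irrefl : ∀ u i → h u i u i ≡ false
  h-irrefl u i rewrite eqᵇ-refl u | eqᵇ-refl i | irrefl G u = refl
  h-complete : ∀ u i j → i ≢ j → h u i u j ≡ true
  h-complete u i j i≢j rewrite eqᵇ-refl u | eqᵇ-≢ i≢j = refl
  h⇒ : ∀ {u v i j} → u ≢ v → h u i v j ≡ true → adj G u v ≡ true × i ≡ j
  h⇒ {i = i} {j} u≢v eq rewrite eqᵇ-≢ u≢v = proj₁ (∧-true eq) , eqᵇ⇒≡ i j (proj₂ (∧-true eq))

PDPcover-canonical≤P : ∀ (G : Graph n) m → PDPcover (canonicalCover G m) ≤ P G m
PDPcover-canonical≤P {n} G m = countVecs-mono λ c ok → allᵇ⁺ (allFin n) λ {u} _ → allᵇ⁺ (allFin n) λ {v} _ →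
  proper c u v (allᵇ⁻ (allFin n) (allᵇ⁻ (allFin n) ok (∈-allFin u)) (∈-allFin v))
  where
  proper : ∀ (c : Vec (Fin m) n) u v → eqᵇ u v ∨ not (hadj (canonicalCover G m) u (lookup c u) v (lookup c v)) ≡ true →
    not (adj G u v ∧ eqᵇ (lookup c u) (lookup c v)) ≡ true
  proper c u v eq with u ≟ v
  ... | yes refl rewrite irrefl G u = refl
  ... | no _ = eq

-- The bound on the difference

difference-bound : ∀ g → Odd g → 3 ≤ g → (G : Graph n) → (∀ j → j < g → ¬ CycleOfLength G j) →
  ∀ m d → IsPDP G m d → ∣ P G m - d ∣ * m ^ g ≤ 2 ^ length (edges G) * m ^ n
difference-bound {n} g g-odd 3≤g G no-short-cycle m d ((H , H≡d) , d-min) with m≤n⇒∃[o]m+o≡n 3≤g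
... | t , refl = begin
  -- Because d is at most `P G m`, the absolute difference is a truncated subtraction.
  ∣ P G m - d ∣ * q     ≡⟨ cong (_* q) (m≤n⇒∣n-m∣≡n∸m d≤P) ⟩
  (P G m ∸ d) * q       ≡⟨ *-distribʳ-∸ q (P G m) d ⟩
  P G m * q ∸ d * q     ≤⟨ m≤n+o⇒m∸n≤o (P G m * q) (d * q) P≤d+slack ⟩
  slack                 ∎
  where
  open ≤-Reasoning
  q = m ^ (3 + t)
  slack = 2 ^ length (edges G) * m ^ n
  d≤P : d ≤ P G m
  d≤P = ≤-trans (d-min (canonicalCover G m)) (PDPcover-canonical≤P G m)
  P≤d+slack : P G m * q ≤ d * q + slack
  P≤d+slack = begin
    P G m * q                                       ≤⟨ *-monoˡ-≤ q (P≤#mixed G m) ⟩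
    #mixed {m = m} untwisted [] (edges G) * q       ≤⟨ even-bound G t g-odd no-short-cycle σ[ H ] [] (edges G)
                                                         (extends-resp-⊆ G (minimum _) (extends-edges G)) (extends-edges G) (0 , refl) ⟩
    #mixed σ[ H ] [] (edges G) * q + slack          ≤⟨ +-monoˡ-≤ slack (*-monoˡ-≤ q (#mixed≤PDPcover H)) ⟩
    PDPcover H * q + slack                          ≡⟨ cong (λ x → x * q + slack) H≡d ⟩
    d * q + slack                                   ∎

no-cycle-<3 : ∀ (G : Graph n) j → j < 3 → ¬ CycleOfLength G j
no-cycle-<3 G (suc j) (s≤s j<2) (2≤j , _) = <⇒≱ j<2 2≤j

theorem6 : (∀ (g n : ℕ) → Odd g → 3 ≤ g → (G : Graph n) → HasGirth G g ⊎ HasGirth G (suc g) →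
    ∃[ C ] ∃[ M ] ∀ (m : ℕ) → M ≤ m → ∀ (d : ℕ) → IsPDP G m d →
    ∣ P G m - d ∣ * m ^ g ≤ C * m ^ n)
    ×
    (∀ (n : ℕ) → 1 ≤ n → (G : Graph n) →
    ∃[ C ] ∃[ M ] ∀ (m : ℕ) → M ≤ m → ∀ (d : ℕ) → IsPDP G m d →
    ∣ P G m - d ∣ * m ^ 3 ≤ C * m ^ n)
theorem6 =
  -- The constant depends on `G` alone, and the threshold is 0 because the bound holds for every
  -- `m`.
  (λ g n g-odd 3≤g G girth → 2 ^ length (edges G) , 0 , λ m _ d →
    difference-bound g g-odd 3≤g G (girth≥ girth) m d) ,
  -- The case g = 3 = 1 + 2 * 1, in which the absence of shorter cycles is automatic.
  (λ n _ G → 2 ^ length (edges G) , 0 , λ m _ d →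
    difference-bound 3 (1 , refl) ≤-refl G (no-cycle-<3 G) m d)
  where
  girth≥ : ∀ {n g} {G : Graph n} → HasGirth G g ⊎ HasGirth G (suc g) → ∀ j → j < g → ¬ CycleOfLength G j
  girth≥ (inj₁ (_ , shortest)) j j<g = shortest j j<g
  girth≥ (inj₂ (_ , shortest)) j j<g = shortest j (m≤n⇒m≤1+n j<g)
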